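{- Let $G$ be a (finite simple) chordal graph and let $x$ be a nondominating vertex of $G$. Then there exists a vertex $y$ in $G$ (with $y\ne x$) such that $y$ is nonadjacent to $x$ and the graph $G+xy$ is also chordal.
   Context: All graphs are finite and simple. A chord of a cycle $C$ in a graph is an edge of the graph not in $E(C)$ both of whose endpoints lie on $C$. A graph is chordal if every cycle of length greater than three has a chord (equivalently, it contains no induced cycle of length greater than three). Chordal graphs are not required to be connected. A vertex $x$ in a graph of order (number of vertices) $n$ is called dominating if its degree is $n-1$; otherwise it is nondominating. For nonadjacent distinct vertices $x,y$ of $G$, $G+xy$ denotes the graph obtained from $G$ by adding the edge $xy$. -}

module Defs where

open import Level using (0ℓ)
open import Data.Nat.Base using (ℕ; suc; _∸_; _≤_; _<_)
open import Data.Fin.Base using (Fin; toℕ)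
open import Data.Fin.Properties using (_≟_)
open import Data.Fin.Subset using (Subset; ∣_∣)
open import Data.Product.Base as Product using (_×_; _,_; ∃; ∃₂)
open import Data.Sum.Base as Sum using (_⊎_; inj₁; inj₂)
open import Data.Vec.Base using (tabulate)
open import Function.Base using (_∘_)
open import Function.Definitions using (Injective)
open import Relation.Binary.Core using (Rel)
open import Relation.Binary.Definitions using (Decidable; Irreflexive; Symmetric)
open import Relation.Binary.PropositionalEquality.Core using (_≡_; _≢_; refl; sym; trans)
open import Relation.Nullary using (¬_; does)
open import Relation.Nullary.Decidable using (_×-dec_; _⊎-dec_)

-- Adjacency is decidable so that degrees are numbers; classically this is
-- no restriction.
record Graph (n : ℕ) : Set₁ where
  field
    Adj        : Rel (Fin n) 0ℓ
    adj?       : Decidable Adj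
    adj-sym    : Symmetric Adj
    adj-irrefl : Irreflexive _≡_ Adj

open Graph public

neighbourhood : ∀ {n} → Graph n → Fin n → Subset n
neighbourhood G x = tabulate (λ y → does (adj? G x y))

degree : ∀ {n} → Graph n → Fin n → ℕ
degree G x = ∣ neighbourhood G x ∣

-- Truncated subtraction is harmless: a vertex x : Fin n forces n ≥ 1.
Dominating : ∀ {n} → Graph n → Fin n → Set
Dominating {n} G x = degree G x ≡ n ∸ 1

-- j follows i in the cyclic order 0, 1, …, k-1, 0.
Next : ∀ {k} → Rel (Fin k) 0ℓ
Next {k} i j = suc (toℕ i) ≡ toℕ j ⊎ (suc (toℕ i) ≡ k × toℕ j ≡ 0)

record Cycle {n} (G : Graph n) : Set where
  field
    length    : ℕ
    length≥3  : 3 ≤ length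
    vertex    : Fin length → Fin n
    injective : Injective _≡_ _≡_ vertex
    adjacent  : ∀ {i j} → Next i j → Adj G (vertex i) (vertex j)

  OnCycle : Fin n → Set
  OnCycle u = ∃ λ i → vertex i ≡ u

  CycleEdge : Rel (Fin n) 0ℓ
  CycleEdge u v = ∃₂ λ i j → Next i j ×
    ((vertex i ≡ u × vertex j ≡ v) ⊎ (vertex i ≡ v × vertex j ≡ u))

  Chord : Rel (Fin n) 0ℓ
  Chord u v = Adj G u v × ¬ CycleEdge u v × OnCycle u × OnCycle v

Chordal : ∀ {n} → Graph n → Set
Chordal G = (C : Cycle G) → 3 < Cycle.length C → ∃₂ (Cycle.Chord C)

addEdge : ∀ {n} (G : Graph n) (x y : Fin n) → x ≢ y → Graph n
addEdge {n} G x y x≢y = record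
  { Adj        = Adj′
  ; adj?       = λ u v → adj? G u v ⊎-dec
                   ((u ≟ x ×-dec v ≟ y) ⊎-dec (u ≟ y ×-dec v ≟ x))
  ; adj-sym    = Sum.map (adj-sym G) (Sum.swap ∘ Sum.map Product.swap Product.swap)
  ; adj-irrefl = irrefl
  }
  where
  Adj′ : Rel (Fin n) 0ℓ
  Adj′ u v = Adj G u v ⊎ ((u ≡ x × v ≡ y) ⊎ (u ≡ y × v ≡ x))

  irrefl : Irreflexive _≡_ Adj′
  irrefl u≡v  (inj₁ u~v)                 = adj-irrefl G u≡v u~v
  irrefl refl (inj₂ (inj₁ (u≡x , u≡y))) = x≢y (trans (sym u≡x) u≡y)
  irrefl refl (inj₂ (inj₂ (u≡y , u≡x))) = x≢y (trans (sym u≡x) u≡y)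

{-# OPTIONS --safe #-}

-- Choose y among the non-neighbours of x so that x and y have as many common
-- neighbours as possible. A chordless cycle of length > 3 in G + xy must use
-- the edge xy, hence comes from an induced path x = p₀, p₁, …, pₘ = y of G
-- with m ≥ 3. In a chordal graph a common neighbour of the two ends of such a
-- path is adjacent to all of its vertices, so every common neighbour of x and
-- y is one of x and p₂. But p₁ is also a common neighbour of x and p₂, and it
-- is not adjacent to y: this contradicts the choice of y.
module Submission where

open import Defs
open import Data.Nat.Base using (ℕ; zero; suc; _+_; _*_; _∸_; _≤_; _<_; z≤n; s≤s; z<s)
open import Data.Nat.Properties as ℕ
  using (≤-refl; ≤-trans; ≤-reflexive; <⇒≤; suc-injective)
open import Data.Nat.DivMod
  using (_%_; _mod_; %-distribˡ-+; m%n<n; m%n%n≡m%n; m<n⇒m%n≡m; n%n≡0;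
         [m+n]%n≡m%n; [m+kn]%n≡m%n)
open import Data.Nat.Induction using (<-rec)
open import Data.Fin.Base using (Fin; zero; suc; toℕ; fromℕ<)
open import Data.Fin.Properties using (_≟_; any?; toℕ<n; toℕ≤pred[n]; toℕ-injective; toℕ-fromℕ<)
open import Data.Fin.Subset using (_∈_; _∩_; _⊆_; ∁; ⁅_⁆; ∣_∣)
open import Data.Fin.Subset.Properties
  using (⊆-antisym; x∈p∩q⁺; x∈p∩q⁻; x∈⁅x⁆; x∈⁅y⁆⇒x≡y; x∈∁p⇒x∉p; x∉p⇒x∈∁p;
         ∣∁p∣≡n∸∣p∣; ∣⁅x⁆∣≡1; p⊂q⇒∣p∣<∣q∣)
open import Data.List.Base using (filter; allFin)
open import Data.List.Extrema.Nat using (argmax; argmax-all; f[xs]≤f[argmax])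
open import Data.List.Membership.Propositional.Properties using (∈-filter⁺; ∈-allFin)
open import Data.List.Relation.Unary.All as All using ()
open import Data.List.Relation.Unary.All.Properties using (all-filter)
open import Data.Product.Base using (Σ-syntax; ∃-syntax; ∃; ∃₂; _×_; _,_; proj₂)
open import Data.Sum.Base as Sum using (_⊎_; inj₁; inj₂; [_,_]′)
open import Data.Vec.Properties using (lookup∘tabulate; []=⇒lookup; lookup⇒[]=)
open import Function.Base using (_∘_; id)
open import Relation.Binary.Definitions using (Decidable; tri<; tri≈; tri>)
open import Relation.Binary.PropositionalEquality
  using (_≡_; _≢_; refl; sym; trans; cong; subst; subst₂; module ≡-Reasoning)
open import Relation.Nullary using (¬_; yes; no; does; contradiction)
open import Relation.Nullary.Decidable
  using (_×-dec_; _⊎-dec_; ¬?; dec-true; decidable-stable)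
import Relation.Unary as Unary

private
  variable
    n m : ℕ
    G : Graph n
    x y z : Fin n

-- Neighbourhoods, non-neighbours and maximisers

∈-neighbourhood⁺ : Adj G x y → y ∈ neighbourhood G x
∈-neighbourhood⁺ {G = G} {x = x} {y = y} x~y =
  lookup⇒[]= y _ (trans (lookup∘tabulate _ y) (dec-true (adj? G x y) x~y))

∈-neighbourhood⁻ : y ∈ neighbourhood G x → Adj G x y
∈-neighbourhood⁻ {y = y} {G = G} {x = x} y∈N
  with adj? G x y | trans (sym (lookup∘tabulate (λ w → does (adj? G x w)) y)) ([]=⇒lookup y∈N)
... | yes x~y | _ = x~y
... | no _    | ()

NonNeighbour : Graph n → Fin n → Fin n → Set
NonNeighbour G x y = x ≢ y × ¬ Adj G x y

nonNeighbour? : (G : Graph n) → Decidable (NonNeighbour G)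
nonNeighbour? G x y = ¬? (x ≟ y) ×-dec ¬? (adj? G x y)

-- If `x` has no non-neighbour, its neighbourhood is the complement of `⁅ x ⁆`, which has `n ∸ 1`
-- elements.
nondominating⇒∃nonNeighbour : (G : Graph n) → ¬ Dominating G x → ∃ (NonNeighbour G x)
nondominating⇒∃nonNeighbour {n = n} {x = x} G nondom with any? (nonNeighbour? G x)
... | yes found = found
... | no ¬found = contradiction dominating nondom
  where
  N⊆ : neighbourhood G x ⊆ ∁ ⁅ x ⁆
  N⊆ y∈N = x∉p⇒x∈∁p λ y∈x →
    adj-irrefl G (sym (x∈⁅y⁆⇒x≡y x y∈x)) (∈-neighbourhood⁻ {G = G} y∈N)

  ⊆N : ∁ ⁅ x ⁆ ⊆ neighbourhood G x
  ⊆N {y} y∉x = ∈-neighbourhood⁺ {G = G} (decidable-stable (adj? G x y) λ x≁y →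
    ¬found (y , (λ { refl → x∈∁p⇒x∉p y∉x (x∈⁅x⁆ x) }) , x≁y))

  dominating : Dominating G x
  dominating = begin
    ∣ neighbourhood G x ∣ ≡⟨ cong ∣_∣ (⊆-antisym N⊆ ⊆N) ⟩
    ∣ ∁ ⁅ x ⁆ ∣           ≡⟨ ∣∁p∣≡n∸∣p∣ ⁅ x ⁆ ⟩
    n ∸ ∣ ⁅ x ⁆ ∣         ≡⟨ cong (n ∸_) (∣⁅x⁆∣≡1 x) ⟩
    n ∸ 1                 ∎
    where open ≡-Reasoning

argmax-satisfying : ∀ {P : Fin n → Set} → Unary.Decidable P → (f : Fin n → ℕ) → ∃ P →
  ∃[ y ] P y × (∀ z → P z → f z ≤ f y)
argmax-satisfying {n = n} P? f (w , Pw) =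
  -- `w` is the default value of `argmax`; as it satisfies `P`, so does the maximiser in every case.
  argmax f w candidates ,
  argmax-all f Pw (all-filter P? (allFin n)) ,
  λ z Pz → All.lookup (f[xs]≤f[argmax] {f = f} w candidates) (∈-filter⁺ P? (∈-allFin z) Pz)
  where candidates = filter P? (allFin n)

-- Chords and chordless cycles

next? : ∀ {k} → Decidable (Next {k})
next? {k} i j = (suc (toℕ i) ℕ.≟ toℕ j) ⊎-dec ((suc (toℕ i) ℕ.≟ k) ×-dec (toℕ j ℕ.≟ 0))

-- Phrased by positions on the cycle rather than by its vertices, so that arithmetic on indices
-- applies.
Chordless : {G : Graph n} → Cycle G → Set
Chordless {G = G} C = ∀ i j → Adj G (vertex i) (vertex j) → Next i j ⊎ Next j i
  where open Cycle C

chordless⇒¬chord : (C : Cycle G) → Chordless C → ¬ ∃₂ (Cycle.Chord C)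
chordless⇒¬chord C chordless (_ , _ , u~v , ¬edge , (i , refl) , (j , refl)) =
  ¬edge ([ (λ i→j → i , j , i→j , inj₁ (refl , refl))
         , (λ j→i → j , i , j→i , inj₂ (refl , refl)) ]′ (chordless i j u~v))

module _ {G : Graph n} (C : Cycle G) where
  open Cycle C

  cycleEdge? : Decidable CycleEdge
  cycleEdge? u v = any? λ i → any? λ j → next? i j ×-dec
    ((vertex i ≟ u ×-dec vertex j ≟ v) ⊎-dec (vertex i ≟ v ×-dec vertex j ≟ u))

  chord? : Decidable Chord
  chord? u v = adj? G u v ×-dec ¬? (cycleEdge? u v) ×-dec
    any? (λ i → vertex i ≟ u) ×-dec any? (λ i → vertex i ≟ v)

  ¬chord⇒chordless : ¬ ∃₂ Chord → Chordless C
  ¬chord⇒chordless ¬chord i j i~j =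
    -- Being consecutive is decidable; if it fails, injectivity of `vertex` shows that the edge is
    -- not a cycle edge, hence is a chord.
    decidable-stable (next? i j ⊎-dec next? j i) λ ¬next →
      ¬chord (_ , _ , i~j , ¬next ∘ edge⇒next , (i , refl) , (j , refl))
    where
    edge⇒next : CycleEdge (vertex i) (vertex j) → Next i j ⊎ Next j i
    edge⇒next (a , b , a→b , inj₁ (a≡i , b≡j)) =
      inj₁ (subst₂ Next (injective a≡i) (injective b≡j) a→b)
    edge⇒next (a , b , a→b , inj₂ (a≡j , b≡i)) =
      inj₂ (subst₂ Next (injective a≡j) (injective b≡i) a→b)

-- Induced paths

-- The path has vertices p 0, …, p m; the values of p beyond m are junk.
record InducedPath (G : Graph n) (p : ℕ → Fin n) (m : ℕ) : Set where
  field
    injective   : ∀ {i j} → i ≤ m → j ≤ m → p i ≡ p j → i ≡ j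
    adjacent    : ∀ {i} → i < m → Adj G (p i) (p (suc i))
    nonadjacent : ∀ {i j} → suc i < j → j ≤ m → ¬ Adj G (p i) (p j)

module _ {G : Graph n} {p : ℕ → Fin n} {m : ℕ} (P : InducedPath G p m) where
  open InducedPath P

  take-path : ∀ {k} → k ≤ m → InducedPath G p k
  take-path k≤m = record
    { injective   = λ i≤k j≤k → injective (≤-trans i≤k k≤m) (≤-trans j≤k k≤m)
    ; adjacent    = λ i<k → adjacent (≤-trans i<k k≤m)
    ; nonadjacent = λ i<j j≤k → nonadjacent i<j (≤-trans j≤k k≤m)
    }

  reverse-path : InducedPath G (λ i → p (m ∸ i)) m
  reverse-path = record
    { injective   = λ {i} {j} i≤m j≤m eq →
        ℕ.∸-cancelˡ-≡ i≤m j≤m (injective (ℕ.m∸n≤m m i) (ℕ.m∸n≤m m j) eq)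
    ; adjacent    = λ {i} i<m → adj-sym G (subst (λ k → Adj G (p (m ∸ suc i)) (p k))
        (sym (ℕ.+-∸-assoc 1 i<m))
        (adjacent (subst (_≤ m) (ℕ.+-∸-assoc 1 i<m) (ℕ.m∸n≤m m i))))
    ; nonadjacent = λ {i} {j} i<j j≤m → nonadjacent
        (subst (_< m ∸ i) (ℕ.+-∸-assoc 1 j≤m) (ℕ.∸-monoʳ-< i<j (ℕ.m≤n⇒m≤1+n j≤m)))
        (ℕ.m∸n≤m m i) ∘ adj-sym G
    }

drop-path : ∀ {p} a → InducedPath G p (a + m) → InducedPath G (λ i → p (a + i)) m
drop-path {G = G} {m = m} {p = p} a P = record
  { injective   = λ i≤m j≤m eq →
      ℕ.+-cancelˡ-≡ a _ _ (injective (ℕ.+-monoʳ-≤ a i≤m) (ℕ.+-monoʳ-≤ a j≤m) eq)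
  ; adjacent    = λ {i} i<m → subst (Adj G (p (a + i)) ∘ p) (sym (ℕ.+-suc a i))
      (adjacent (subst (_≤ a + m) (ℕ.+-suc a i) (ℕ.+-monoʳ-≤ a i<m)))
  ; nonadjacent = λ {i} {j} i<j j≤m → nonadjacent
      (subst (_≤ a + j) (trans (ℕ.+-suc a (suc i)) (cong suc (ℕ.+-suc a i))) (ℕ.+-monoʳ-≤ a i<j))
      (ℕ.+-monoʳ-≤ a j≤m)
  }
  where open InducedPath P

-- The cycle formed by a path and a vertex off it

module Cone {G : Graph n} {p : ℕ → Fin n} {m : ℕ} (P : InducedPath G p m) (1≤m : 1 ≤ m)
  (z : Fin n) (z∉P : ∀ {i} → i ≤ m → z ≢ p i)
  (z~p₀ : Adj G z (p 0)) (z~pₘ : Adj G z (p m)) where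
  open InducedPath P

  -- With the apex at position 0, the edge from `p m` back to `z` is the wrap-around case of `Next`.
  cone-vertex : Fin (2 + m) → Fin n
  cone-vertex zero    = z
  cone-vertex (suc a) = p (toℕ a)

  cone : Cycle G
  cone = record
    { length    = 2 + m
    ; length≥3  = s≤s (s≤s 1≤m)
    ; vertex    = cone-vertex
    ; injective = λ {i} {j} → inj i j
    ; adjacent  = λ {i} {j} → adj i j
    }
    where
    inj : ∀ i j → cone-vertex i ≡ cone-vertex j → i ≡ j
    inj zero    zero    eq = refl
    inj zero    (suc b) eq = contradiction eq (z∉P (toℕ≤pred[n] b))
    inj (suc a) zero    eq = contradiction (sym eq) (z∉P (toℕ≤pred[n] a))
    inj (suc a) (suc b) eq =
      cong suc (toℕ-injective (injective (toℕ≤pred[n] a) (toℕ≤pred[n] b) eq))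

    adj : ∀ i j → Next i j → Adj G (cone-vertex i) (cone-vertex j)
    adj zero    (suc b) (inj₁ eq) = subst (Adj G z ∘ p) (suc-injective eq) z~p₀
    adj (suc a) (suc b) (inj₁ eq) = subst (Adj G _ ∘ p) (suc-injective eq)
      (adjacent (subst (_≤ m) (sym (suc-injective eq)) (toℕ≤pred[n] b)))
    adj (suc a) zero    (inj₂ (eq , _)) = adj-sym G
      (subst (Adj G z ∘ p) (sym (suc-injective (suc-injective eq))) z~pₘ)

  cone-chordless : (∀ {i} → 0 < i → i < m → ¬ Adj G z (p i)) → Chordless cone
  cone-chordless z≁P = chordless
    where
    apex : ∀ (b : Fin (suc m)) → Adj G z (p (toℕ b)) →
      Next {2 + m} zero (suc b) ⊎ Next {2 + m} (suc b) zero
    apex zero    _ = inj₁ (inj₁ refl)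
    -- The path index here is `suc (toℕ b)`: below `m` it is an inner vertex, and at `m` it is the
    -- last position of the cone.
    apex (suc b) z~b with ℕ.m≤n⇒m<n∨m≡n (toℕ<n b)
    ... | inj₁ b<m = contradiction z~b (z≁P z<s b<m)
    ... | inj₂ b≡m = inj₂ (inj₂ (cong (2 +_) b≡m , refl))

    base : ∀ {a b} → a < b → b ≤ m → Adj G (p a) (p b) → suc a ≡ b
    base a<b b≤m a~b with ℕ.m≤n⇒m<n∨m≡n a<b
    ... | inj₁ 1+a<b = contradiction a~b (nonadjacent 1+a<b b≤m)
    ... | inj₂ 1+a≡b = 1+a≡b

    chordless : Chordless cone
    chordless zero    zero    e = contradiction e (adj-irrefl G refl)
    chordless zero    (suc b) e = apex b e
    chordless (suc a) zero    e = Sum.swap (apex a (adj-sym G e))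
    chordless (suc a) (suc b) e with ℕ.<-cmp (toℕ a) (toℕ b)
    ... | tri< a<b _ _ = inj₁ (inj₁ (cong suc (base a<b (toℕ≤pred[n] b) e)))
    ... | tri≈ _ a≡b _ = contradiction e (adj-irrefl G (cong p a≡b))
    ... | tri> _ _ b<a = inj₂ (inj₁ (cong suc (base b<a (toℕ≤pred[n] a) (adj-sym G e))))

-- If z has no neighbour strictly inside the path, then z and the path form a
-- chordless cycle; otherwise the path is split at such a neighbour.
adjacent-to-ends⇒adjacent-to-path : Chordal G → ∀ m {p} → InducedPath G p m →
  (∀ {i} → i ≤ m → z ≢ p i) → Adj G z (p 0) → Adj G z (p m) →
  ∀ {i} → i ≤ m → Adj G z (p i)
adjacent-to-ends⇒adjacent-to-path {G = G} {z = z} chordal = <-rec Goal step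
  where
  Goal : ℕ → Set
  Goal m = ∀ {p} → InducedPath G p m → (∀ {i} → i ≤ m → z ≢ p i) →
    Adj G z (p 0) → Adj G z (p m) → ∀ {i} → i ≤ m → Adj G z (p i)

  step : ∀ m → (∀ {k} → k < m → Goal k) → Goal m
  step zero    rec P z∉P z~p₀ z~pₘ z≤n = z~p₀
  step (suc zero) rec P z∉P z~p₀ z~pₘ z≤n = z~p₀
  step (suc zero) rec P z∉P z~p₀ z~pₘ (s≤s z≤n) = z~pₘ
  step m@(suc (suc _)) rec {p} P z∉P z~p₀ z~pₘ {i} i≤m
    with any? {n = m} (λ a → (0 ℕ.<? toℕ a) ×-dec adj? G z (p (toℕ a)))
  -- Now `2 ≤ m`, so the cone has length at least 4 and must have a chord.
  ... | no ¬inner = contradiction (chordal cone (s≤s (s≤s (s≤s z<s))))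
          (chordless⇒¬chord cone (cone-chordless z≁P))
    where
    open Cone P z<s z z∉P z~p₀ z~pₘ
    z≁P : ∀ {i} → 0 < i → i < m → ¬ Adj G z (p i)
    z≁P 0<i i<m z~i = ¬inner (fromℕ< i<m ,
      subst (0 <_) (sym (toℕ-fromℕ< i<m)) 0<i ,
      subst (Adj G z ∘ p) (sym (toℕ-fromℕ< i<m)) z~i)
  -- Both pieces are shorter than the path because `0 < a < m`.
  ... | yes (a , 0<a , z~a) with ℕ.≤-total i (toℕ a)
  ...   | inj₁ i≤a = rec (toℕ<n a) (take-path P a≤m) (λ j≤a → z∉P (≤-trans j≤a a≤m)) z~p₀ z~a i≤a
    where a≤m = <⇒≤ (toℕ<n a)
  ...   | inj₂ a≤i = subst (Adj G z ∘ p) (ℕ.m+[n∸m]≡n a≤i)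
    (rec (ℕ.∸-monoʳ-< 0<a a≤m)
      (drop-path (toℕ a) (subst (InducedPath G p) (sym a+[m∸a]≡m) P))
      (λ {j} j≤m∸a → z∉P (subst (toℕ a + j ≤_) a+[m∸a]≡m (ℕ.+-monoʳ-≤ (toℕ a) j≤m∸a)))
      (subst (Adj G z ∘ p) (sym (ℕ.+-identityʳ (toℕ a))) z~a)
      (subst (Adj G z ∘ p) (sym a+[m∸a]≡m) z~pₘ)
      (ℕ.∸-monoˡ-≤ (toℕ a) i≤m))
    where
    a≤m = <⇒≤ (toℕ<n a)
    a+[m∸a]≡m = ℕ.m+[n∸m]≡n a≤m

-- Common neighbours along an induced path

commonNeighbours : Graph n → Fin n → Fin n → ℕ
commonNeighbours G x y = ∣ neighbourhood G x ∩ neighbourhood G y ∣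

-- The one set of common neighbours lies strictly inside the other, and `p 1` is the element gained.
commonNeighbours-increase : Chordal G → ∀ {p} → InducedPath G p m → 3 ≤ m →
  commonNeighbours G (p 0) (p m) < commonNeighbours G (p 0) (p 2)
commonNeighbours-increase {G = G} {m = m} chordal {p} P 3≤m =
  p⊂q⇒∣p∣<∣q∣ (included , p 1 , p₁∈ , p₁∉)
  where
  open InducedPath P

  -- No path vertex is adjacent to both ends: `p 0` is not adjacent to itself, `p 1` is not adjacent
  -- to `p m` as `3 ≤ m`, and later ones are not adjacent to `p 0`.
  off-path : Adj G z (p 0) → Adj G z (p m) → ∀ {i} → i ≤ m → z ≢ p i
  off-path z~p₀ z~pₘ {0} i≤m refl = adj-irrefl G refl z~p₀
  off-path z~p₀ z~pₘ {1} i≤m refl = nonadjacent 3≤m ≤-refl z~pₘ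
  off-path z~p₀ z~pₘ {suc (suc i)} i≤m refl = nonadjacent (s≤s z<s) i≤m (adj-sym G z~p₀)

  included : neighbourhood G (p 0) ∩ neighbourhood G (p m) ⊆
             neighbourhood G (p 0) ∩ neighbourhood G (p 2)
  included z∈ with x∈p∩q⁻ (neighbourhood G (p 0)) _ z∈
  ... | z∈N₀ , z∈Nₘ = x∈p∩q⁺ (z∈N₀ , ∈-neighbourhood⁺ {G = G} (adj-sym G
    (adjacent-to-ends⇒adjacent-to-path chordal m P (off-path z~p₀ z~pₘ) z~p₀ z~pₘ (<⇒≤ 3≤m))))
    where
    z~p₀ = adj-sym G (∈-neighbourhood⁻ {G = G} z∈N₀)
    z~pₘ = adj-sym G (∈-neighbourhood⁻ {G = G} z∈Nₘ)

  p₁∈ : p 1 ∈ neighbourhood G (p 0) ∩ neighbourhood G (p 2)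
  p₁∈ = x∈p∩q⁺
    ( ∈-neighbourhood⁺ {G = G} (adjacent (≤-trans z<s 3≤m))
    , ∈-neighbourhood⁺ {G = G} (adj-sym G (adjacent (<⇒≤ 3≤m))))

  p₁∉ : ¬ p 1 ∈ neighbourhood G (p 0) ∩ neighbourhood G (p m)
  p₁∉ p₁∈N = nonadjacent 3≤m ≤-refl
    (adj-sym G (∈-neighbourhood⁻ {G = G} (proj₂ (x∈p∩q⁻ (neighbourhood G (p 0)) _ p₁∈N))))

-- Rotating a cyclic order by arithmetic modulo its length

module _ (m : ℕ) where
  private k = suc m

  %-remove-%ʳ : ∀ a b → (a + b % k) % k ≡ (a + b) % k
  %-remove-%ʳ a b = begin
    (a + b % k) % k           ≡⟨ %-distribˡ-+ a (b % k) k ⟩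
    (a % k + b % k % k) % k   ≡⟨ cong (λ r → (a % k + r) % k) (m%n%n≡m%n b k) ⟩
    (a % k + b % k) % k       ≡⟨ %-distribˡ-+ a b k ⟨
    (a + b) % k               ∎
    where open ≡-Reasoning

  -- Adding a * m undoes adding a, as a * m + a = a * k.
  +-cancelˡ-% : ∀ a {s t} → (a + s) % k ≡ (a + t) % k → s % k ≡ t % k
  +-cancelˡ-% a {s} {t} eq = trans (sym (undo s)) (trans (cong (λ r → (a * m + r) % k) eq) (undo t))
    where
    open ≡-Reasoning
    a*m+a≡a*k : a * m + a ≡ a * k
    a*m+a≡a*k = trans (ℕ.+-comm (a * m) a) (sym (ℕ.*-suc a m))

    undo : ∀ s → (a * m + (a + s) % k) % k ≡ s % k
    undo s = begin
      (a * m + (a + s) % k) % k ≡⟨ %-remove-%ʳ (a * m) (a + s) ⟩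
      (a * m + (a + s)) % k     ≡⟨ cong (_% k) (ℕ.+-assoc (a * m) a s) ⟨
      (a * m + a + s) % k       ≡⟨ cong (λ r → (r + s) % k) a*m+a≡a*k ⟩
      (a * k + s) % k           ≡⟨ cong (_% k) (ℕ.+-comm (a * k) s) ⟩
      (s + a * k) % k           ≡⟨ [m+kn]%n≡m%n s a k ⟩
      s % k                     ∎

  toℕ-mod : ∀ t → toℕ (t mod k) ≡ t % k
  toℕ-mod t = toℕ-fromℕ< (m%n<n t k)

  -- Merges the two cases of `Next` into one congruence, which is stable under rotation.
  next⇒% : {i j : Fin k} → Next i j → toℕ j ≡ suc (toℕ i) % k
  next⇒% {i} {j} (inj₁ eq)       = trans (sym (m<n⇒m%n≡m (toℕ<n j))) (cong (_% k) (sym eq))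
  next⇒% (inj₂ (eq , j≡0)) = trans j≡0 (trans (sym (n%n≡0 k)) (cong (_% k) (sym eq)))

  %⇒next : {i j : Fin k} → toℕ j ≡ suc (toℕ i) % k → Next i j
  %⇒next {i} {j} eq with ℕ.m≤n⇒m<n∨m≡n (toℕ<n i)
  ... | inj₁ 1+i<k = inj₁ (sym (trans eq (m<n⇒m%n≡m 1+i<k)))
  ... | inj₂ 1+i≡k = inj₂ (1+i≡k , trans eq (trans (cong (_% k) 1+i≡k) (n%n≡0 k)))

  next-mod : ∀ t → Next (t mod k) (suc t mod k)
  next-mod t = %⇒next (begin
    toℕ (suc t mod k)       ≡⟨ toℕ-mod (suc t) ⟩
    suc t % k               ≡⟨ %-remove-%ʳ 1 t ⟨
    suc (t % k) % k         ≡⟨ cong (λ r → suc r % k) (toℕ-mod t) ⟨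
    suc (toℕ (t mod k)) % k ∎)
    where open ≡-Reasoning

  mod-injective : ∀ s {t t′} → t ≤ m → t′ ≤ m → (s + t) mod k ≡ (s + t′) mod k → t ≡ t′
  mod-injective s {t} {t′} t≤m t′≤m eq = begin
    t      ≡⟨ m<n⇒m%n≡m (s≤s t≤m) ⟨
    t % k  ≡⟨ +-cancelˡ-% s (trans (sym (toℕ-mod (s + t))) (trans (cong toℕ eq) (toℕ-mod (s + t′)))) ⟩
    t′ % k ≡⟨ m<n⇒m%n≡m (s≤s t′≤m) ⟩
    t′     ∎
    where open ≡-Reasoning

  -- The shift `s` cancels modulo `k`, leaving `t′ ≡ suc t % k`; this wraps around only at `t ≡ m`.
  next-mod⁻ : ∀ s {t t′} → t ≤ m → t′ ≤ m → Next ((s + t) mod k) ((s + t′) mod k) →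
    suc t ≡ t′ ⊎ (t ≡ m × t′ ≡ 0)
  next-mod⁻ s {t} {t′} t≤m t′≤m next =
    Sum.map
      (λ t<m → sym (trans t′≡1+t (m<n⇒m%n≡m (s≤s t<m))))
      (λ t≡m → t≡m , trans t′≡1+t (trans (cong (λ r → suc r % k) t≡m) (n%n≡0 k)))
      (ℕ.m≤n⇒m<n∨m≡n t≤m)
    where
    open ≡-Reasoning
    t′≡1+t : t′ ≡ suc t % k
    t′≡1+t = trans (sym (m<n⇒m%n≡m (s≤s t′≤m))) (+-cancelˡ-% s (begin
      (s + t′) % k                  ≡⟨ toℕ-mod (s + t′) ⟨
      toℕ ((s + t′) mod k)          ≡⟨ next⇒% next ⟩
      suc (toℕ ((s + t) mod k)) % k ≡⟨ cong (λ r → suc r % k) (toℕ-mod (s + t)) ⟩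
      suc ((s + t) % k) % k         ≡⟨ %-remove-%ʳ 1 (s + t) ⟩
      suc (s + t) % k               ≡⟨ cong (_% k) (ℕ.+-suc s t) ⟨
      (s + suc t) % k               ∎))

  mod-start : (j : Fin k) → (toℕ j + 0) mod k ≡ j
  mod-start j = toℕ-injective (begin
    toℕ ((toℕ j + 0) mod k) ≡⟨ toℕ-mod (toℕ j + 0) ⟩
    (toℕ j + 0) % k         ≡⟨ cong (_% k) (ℕ.+-identityʳ (toℕ j)) ⟩
    toℕ j % k               ≡⟨ m<n⇒m%n≡m (toℕ<n j) ⟩
    toℕ j                   ∎)
    where open ≡-Reasoning

  -- As `m` is `k` less one, `m` steps forward from `j` amount to one step back.
  mod-end : {i j : Fin k} → Next i j → (toℕ j + m) mod k ≡ i
  mod-end {i} {j} next = toℕ-injective (begin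
    toℕ ((toℕ j + m) mod k)     ≡⟨ toℕ-mod (toℕ j + m) ⟩
    (toℕ j + m) % k             ≡⟨ cong (λ r → (r + m) % k) (next⇒% next) ⟩
    (suc (toℕ i) % k + m) % k   ≡⟨ cong (_% k) (ℕ.+-comm (suc (toℕ i) % k) m) ⟩
    (m + suc (toℕ i) % k) % k   ≡⟨ %-remove-%ʳ m (suc (toℕ i)) ⟩
    (m + suc (toℕ i)) % k       ≡⟨ cong (_% k) (trans (ℕ.+-suc m (toℕ i)) (ℕ.+-comm k (toℕ i))) ⟩
    (toℕ i + k) % k             ≡⟨ [m+n]%n≡m%n (toℕ i) k ⟩
    toℕ i % k                   ≡⟨ m<n⇒m%n≡m (toℕ<n i) ⟩
    toℕ i                       ∎)
    where open ≡-Reasoning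

-- Long cycles of the graph with the added edge

-- The path runs once around the cycle, from one end of the edge xy to the other.
chordless-through-edge⇒path : (G : Graph n) (x≢y : x ≢ y) → ¬ Adj G x y →
  (C : Cycle (addEdge G x y x≢y)) → 3 < Cycle.length C → Chordless C → Cycle.CycleEdge C x y →
  ∃₂ λ p m → 3 ≤ m × InducedPath G p m × p 0 ≡ x × p m ≡ y
chordless-through-edge⇒path {x = x} {y = y} G x≢y x≁y
  record { length = suc m ; vertex = vertex ; injective = injective ; adjacent = adjacent }
  (s≤s 3≤m) chordless (i , j , i→j , ends) =
  -- The path goes from `vertex j` to `vertex i`, so it is reversed when the cycle traverses the
  -- edge from `x` to `y`.
  [ (λ { (i≡x , j≡y) → _ , m , 3≤m , reverse-path path , trans pₘ≡i i≡x ,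
           trans (cong p (ℕ.n∸n≡0 m)) (trans p₀≡j j≡y) })
  , (λ { (i≡y , j≡x) → p , m , 3≤m , path , trans p₀≡j j≡x , trans pₘ≡i i≡y }) ]′ ends
  where
  -- Starting at the head `j` of the edge, `m` steps reach its tail `i` without traversing the edge
  -- itself.
  p : ℕ → _
  p t = vertex ((toℕ j + t) mod suc m)

  p₀≡j : p 0 ≡ vertex j
  p₀≡j = cong vertex (mod-start m j)

  pₘ≡i : p m ≡ vertex i
  pₘ≡i = cong vertex (mod-end m i→j)

  p-injective : ∀ {t t′} → t ≤ m → t′ ≤ m → p t ≡ p t′ → t ≡ t′
  p-injective t≤m t′≤m = mod-injective m (toℕ j) t≤m t′≤m ∘ injective

  IsXY : (u v : _) → Set
  IsXY u v = (u ≡ x × v ≡ y) ⊎ (u ≡ y × v ≡ x)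

  isXY-ends : ∀ {u v} → IsXY u v → (u ≡ p 0 × v ≡ p m) ⊎ (u ≡ p m × v ≡ p 0)
  isXY-ends (inj₁ (refl , refl)) = [ (λ { (refl , refl) → inj₂ (sym pₘ≡i , sym p₀≡j) })
                                   , (λ { (refl , refl) → inj₁ (sym p₀≡j , sym pₘ≡i) }) ]′ ends
  isXY-ends (inj₂ (refl , refl)) = [ (λ { (refl , refl) → inj₁ (sym p₀≡j , sym pₘ≡i) })
                                   , (λ { (refl , refl) → inj₂ (sym pₘ≡i , sym p₀≡j) }) ]′ ends

  path : InducedPath G p m
  path = record
    { injective   = p-injective
    ; adjacent    = adj
    ; nonadjacent = nonadj
    }
    where
    adj : ∀ {t} → t < m → Adj G (p t) (p (suc t))
    adj {t} t<m with adjacent (subst (Next ((toℕ j + t) mod suc m) ∘ (_mod suc m))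
                                 (sym (ℕ.+-suc (toℕ j) t)) (next-mod m (toℕ j + t)))
    ... | inj₁ e = e
    -- If this step used the added edge, it would join `p 0` and `p m`: then `t ≡ 0` and `m ≡ 1`,
    -- against `3 ≤ m`, or `t ≡ m`, against `t < m`.
    ... | inj₂ isXY with isXY-ends isXY
    ...   | inj₁ (pt≡p₀ , p1+t≡pₘ) = contradiction 3≤m (ℕ.<⇒≱ (s≤s (ℕ.m≤n⇒m≤1+n (≤-reflexive (trans
              (sym (p-injective t<m ≤-refl p1+t≡pₘ)) (cong suc (p-injective (<⇒≤ t<m) z≤n pt≡p₀)))))))
    ...   | inj₂ (pt≡pₘ , _) = contradiction (p-injective (<⇒≤ t<m) ≤-refl pt≡pₘ) (ℕ.<⇒≢ t<m)

    ends-nonadjacent : ¬ Adj G (p 0) (p m)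
    ends-nonadjacent e = [ (λ { (refl , refl) → x≁y (adj-sym G (subst₂ (Adj G) p₀≡j pₘ≡i e)) })
                         , (λ { (refl , refl) → x≁y (subst₂ (Adj G) p₀≡j pₘ≡i e) }) ]′ ends

    nonadj : ∀ {s t} → suc s < t → t ≤ m → ¬ Adj G (p s) (p t)
    nonadj {s} {t} 1+s<t t≤m e =
      -- Chordlessness leaves only cyclically consecutive positions. With `suc s < t` this forces
      -- `s ≡ 0` and `t ≡ m`, the ends, which are not adjacent in `G`.
      [ [ ℕ.<⇒≢ 1+s<t , (λ { (refl , refl) → contradiction 1+s<t λ () }) ]′ ∘ next-mod⁻ m (toℕ j) s≤m t≤m
      , [ (λ { refl → ℕ.<-asym s<t ≤-refl }) , (λ { (refl , refl) → ends-nonadjacent e }) ]′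
          ∘ next-mod⁻ m (toℕ j) t≤m s≤m
      ]′ (chordless _ _ (inj₁ e))
      where
      s<t = <⇒≤ 1+s<t
      s≤m = ≤-trans (<⇒≤ s<t) t≤m

-- All cycle edges already belong to `G`, so `C` is a cycle of `G`, and a chord there is still a
-- chord after adding an edge.
avoids-edge⇒chord : (G : Graph n) (x≢y : x ≢ y) → Chordal G →
  (C : Cycle (addEdge G x y x≢y)) → 3 < Cycle.length C → ¬ Cycle.CycleEdge C x y →
  ∃₂ (Cycle.Chord C)
avoids-edge⇒chord {x = x} {y = y} G x≢y chordal C 3<k ¬xy with chordal C↓ 3<k
  where
  open Cycle C
  C↓ : Cycle G
  C↓ = record
    { length    = length
    ; length≥3  = length≥3
    ; vertex    = vertex
    ; injective = injective
    ; adjacent  = λ i→j →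
        [ id , (λ isXY → contradiction (_ , _ , i→j , isXY) ¬xy) ]′ (adjacent i→j)
    }
... | u , v , u~v , rest = u , v , inj₁ u~v , rest

-- Maximising the number of common neighbours

lemma2 : (n : ℕ) (G : Graph n) → Chordal G →
    (x : Fin n) → ¬ Dominating G x →
    ∃[ y ] Σ[ x≢y ∈ x ≢ y ] (¬ Adj G x y × Chordal (addEdge G x y x≢y))
lemma2 n G chordal x nondom
  with y , (x≢y , x≁y) , y-max ← argmax-satisfying (nonNeighbour? G x) (commonNeighbours G x)
         (nondominating⇒∃nonNeighbour G nondom)
  = y , x≢y , x≁y , chordal′
  where
  ¬inducedPath : ∀ {y} →
    (∀ z → NonNeighbour G x z → commonNeighbours G x z ≤ commonNeighbours G x y) →
    ∀ {p m} → 3 ≤ m → InducedPath G p m → p 0 ≡ x → ¬ p m ≡ y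
  -- `p 2` competes with `y`: it is a non-neighbour of `x` with strictly more common neighbours.
  ¬inducedPath y-max {p} 3≤m P refl refl = ℕ.<⇒≱ (commonNeighbours-increase chordal P 3≤m)
    (y-max (p 2) ((λ eq → contradiction (injective z≤n (<⇒≤ 3≤m) eq) λ ()) ,
                  nonadjacent ≤-refl (<⇒≤ 3≤m)))
    where open InducedPath P

  chordal′ : Chordal (addEdge G x y x≢y)
  chordal′ C 3<k with cycleEdge? C x y
  ... | no ¬xy = avoids-edge⇒chord G x≢y chordal C 3<k ¬xy
  -- Existence of a chord is a finite search, so its absence may be assumed for contradiction.
  ... | yes xy = decidable-stable (any? λ u → any? λ v → chord? C u v) λ ¬chord →
    let p , m , 3≤m , P , p₀≡x , pₘ≡y =
          chordless-through-edge⇒path G x≢y x≁y C 3<k (¬chord⇒chordless C ¬chord) xy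
    in ¬inducedPath y-max 3≤m P p₀≡x pₘ≡y
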